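{- Every formula $\varphi\in\mathcal{L}_\mu$ is equivalent, over the class of path-finite $\mathsf{wK4}$ models (in particular over all finite $\mathsf{wK4}$ models), to a bisimulation-invariant first-order formula $\theta(y)$ in the signature consisting of the binary relation $\sqsubset$ and one unary predicate for each propositional constant; i.e. for every such model $M$ and $w\in M$, $w\in\|\varphi\|_M$ iff $M\models\theta[w]$.
   Context: A Kripke model is $M=\langle M,\sqsubset,\|\cdot\|\rangle$; $\sqsubseteq$ is the reflexive closure of $\sqsubset$. $\mathsf{wK4}$: for all $a\neq c$, $a\sqsubset b\sqsubset c$ implies $a\sqsubset c$. Write $u\prec v$ iff $u\sqsubset v$ and not $v\sqsubset u$. The model is path-finite if $\prec$ is conversely well-founded (there is no infinite sequence $u_0\prec u_1\prec u_2\prec\cdots$). $\mathcal{L}_\mu$ (negation normal form): $\varphi::=\top\mid x\mid p\mid\neg p\mid\varphi\wedge\varphi\mid\varphi\vee\varphi\mid\Diamond\varphi\mid\Box\varphi\mid\nu x.\varphi\mid\mu x.\varphi$, with standard Kripke semantics ($\Diamond$/$\Box$ over $\sqsubset$-successors, $\mu,\nu$ least/greatest fixed points). A bisimulation between models $M,N$ (for a set $P$ of constants) is a relation $\iota\subseteq M\times N$ such that related points agree on all $p\in P$, and the forth and back conditions hold for $\sqsubset$. A first-order formula $\theta(y)$ is bisimulation invariant if whenever $(u,v)$ lies in a bisimulation, $M\models\theta[u]$ iff $N\models\theta[v]$.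
   Formalization: Bisimulation invariance of θ is stated only between path-finite wK4 models; for bisimulations between arbitrary Kripke models the claim fails, e.g. for νx.◇(p ∧ ◇(¬p ∧ x)), which is not modally definable over finite S4 models. -}

module Defs where

open import Data.Fin.Base using (Fin)
open import Data.Nat.Base using (ℕ; suc)
open import Data.Product.Base using (∃; _×_)
open import Data.Sum.Base using (_⊎_)
open import Data.Unit.Polymorphic.Base using (⊤)
open import Data.Vec.Functional using (Vector; []; _∷_)
open import Function.Base using (flip)
open import Function.Bundles using (_⇔_; _↔_)
open import Induction.InfiniteDescent using (InfiniteDescendingSequence)
open import Level using (0ℓ; Lift) renaming (suc to lsuc)
open import Relation.Binary.Core using (Rel; REL)
open import Relation.Binary.PropositionalEquality.Core using (_≡_; _≢_)
open import Relation.Nullary.Negation.Core using (¬_)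
open import Relation.Unary using (Pred; _⊆_)

record Model (P : Set) : Set₁ where
  infix 4 _⊏_ _≺_
  field
    Carrier : Set
    _⊏_     : Rel Carrier 0ℓ
    ‖_‖     : P → Pred Carrier 0ℓ

  _≺_ : Rel Carrier 0ℓ
  u ≺ v = u ⊏ v × ¬ (v ⊏ u)

module _ {P : Set} (M : Model P) where
  open Model M

  WK4 : Set
  WK4 = ∀ {a b c} → a ≢ c → a ⊏ b → b ⊏ c → a ⊏ c

  -- No sequence u₀ ≺ u₁ ≺ u₂ ≺ ⋯.  Given excluded middle this is equivalent
  -- to WellFounded (flip _≺_).
  PathFinite : Set
  PathFinite = ¬ ∃ (InfiniteDescendingSequence (flip _≺_))

  Finite : Set
  Finite = ∃ λ n → Carrier ↔ Fin n

  PathFiniteWK4 : Set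
  PathFiniteWK4 = WK4 × PathFinite

  FiniteWK4 : Set
  FiniteWK4 = WK4 × Finite

-- Formulas of the μ-calculus whose free fixed-point variables are among n de
-- Bruijn indices; Formula P 0 consists of the sentences.
data Formula (P : Set) (n : ℕ) : Set where
  tt′       : Formula P n
  var       : Fin n → Formula P n
  con ¬con  : P → Formula P n
  _∧′_ _∨′_ : Formula P n → Formula P n → Formula P n
  ◇ □       : Formula P n → Formula P n
  ν μ       : Formula P (suc n) → Formula P n

-- The powerset of the carrier is Pred Carrier 0ℓ.  The fixed points are the
-- Knaster–Tarski ones: ν is the union of all post-fixed points and μ the
-- intersection of all pre-fixed points.  Quantifying over Pred Carrier 0ℓ puts
-- the truth set in Set₁; under excluded middle for Set₁ every such truth set
-- is again (equivalent to) an element of Pred Carrier 0ℓ.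
module _ {P : Set} (M : Model P) where
  open Model M

  ⟦_⟧ : ∀ {n} → Formula P n → Vector (Pred Carrier 0ℓ) n → Pred Carrier (lsuc 0ℓ)
  ⟦ tt′ ⟧    ρ w = ⊤
  ⟦ var x ⟧  ρ w = Lift _ (ρ x w)
  ⟦ con p ⟧  ρ w = Lift _ (‖ p ‖ w)
  ⟦ ¬con p ⟧ ρ w = Lift _ (¬ ‖ p ‖ w)
  ⟦ φ ∧′ ψ ⟧ ρ w = ⟦ φ ⟧ ρ w × ⟦ ψ ⟧ ρ w
  ⟦ φ ∨′ ψ ⟧ ρ w = ⟦ φ ⟧ ρ w ⊎ ⟦ ψ ⟧ ρ w
  ⟦ ◇ φ ⟧    ρ w = ∃ λ v → w ⊏ v × ⟦ φ ⟧ ρ v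
  ⟦ □ φ ⟧    ρ w = ∀ v → w ⊏ v → ⟦ φ ⟧ ρ v
  ⟦ ν φ ⟧    ρ w = ∃ λ (S : Pred Carrier 0ℓ) → S ⊆ ⟦ φ ⟧ (S ∷ ρ) × S w
  ⟦ μ φ ⟧    ρ w = ∀ (S : Pred Carrier 0ℓ) → ⟦ φ ⟧ (S ∷ ρ) ⊆ S → S w

-- First-order formulas with equality over one binary predicate and one unary
-- predicate for each p : P, with free variables among n de Bruijn indices.
data FO (P : Set) (n : ℕ) : Set where
  _≐_ _⊏′_  : Fin n → Fin n → FO P n
  pred      : P → Fin n → FO P n
  ¬′_       : FO P n → FO P n
  _∧′_ _∨′_ : FO P n → FO P n → FO P n
  ∃′ ∀′     : FO P (suc n) → FO P n

module _ {P : Set} (M : Model P) where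
  open Model M

  Sat : ∀ {n} → FO P n → Vector Carrier n → Set
  Sat (i ≐ j)    e = e i ≡ e j
  Sat (i ⊏′ j)   e = e i ⊏ e j
  Sat (pred p i) e = ‖ p ‖ (e i)
  Sat (¬′ α)     e = ¬ Sat α e
  Sat (α ∧′ β)   e = Sat α e × Sat β e
  Sat (α ∨′ β)   e = Sat α e ⊎ Sat β e
  Sat (∃′ α)     e = ∃ λ a → Sat α (a ∷ e)
  Sat (∀′ α)     e = ∀ a → Sat α (a ∷ e)

infix 4 _,_⊩_ _⊨_[_]

_,_⊩_ : ∀ {P} (M : Model P) → Model.Carrier M → Formula P 0 → Set₁
M , w ⊩ φ = ⟦_⟧ M φ [] w

_⊨_[_] : ∀ {P} (M : Model P) → FO P 1 → Model.Carrier M → Set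
M ⊨ θ [ w ] = Sat M θ (w ∷ [])

record IsBisimulation {P : Set} (M N : Model P)
                      (ι : REL (Model.Carrier M) (Model.Carrier N) 0ℓ) : Set where
  private
    module M = Model M
    module N = Model N
  field
    atoms : ∀ {u v} → ι u v → ∀ p → M.‖ p ‖ u ⇔ N.‖ p ‖ v
    forth : ∀ {u v u′} → ι u v → u M.⊏ u′ → ∃ λ v′ → v N.⊏ v′ × ι u′ v′
    back  : ∀ {u v v′} → ι u v → v N.⊏ v′ → ∃ λ u′ → u M.⊏ u′ × ι u′ v′

-- Both notions are relative to a class C of models.  For invariance this
-- matters: a formula invariant between models in C need not be invariant
-- between arbitrary models.
module _ {P : Set} (C : Model P → Set) where

  BisimulationInvariantOver : FO P 1 → Set₁
  BisimulationInvariantOver θ =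
    ∀ (M N : Model P) → C M → C N →
    ∀ (ι : REL (Model.Carrier M) (Model.Carrier N) 0ℓ) → IsBisimulation M N ι →
    ∀ u v → ι u v → M ⊨ θ [ u ] ⇔ N ⊨ θ [ v ]

  EquivalentOver : Formula P 0 → FO P 1 → Set₁
  EquivalentOver φ θ =
    ∀ (M : Model P) → C M → ∀ (w : Model.Carrier M) → M , w ⊩ φ ⇔ M ⊨ θ [ w ]

{-# OPTIONS --safe #-}

-- Record at every point the truth values of all subformulas, the body of a
-- fixed-point formula being evaluated at the fixed point; this gives finitely
-- many types.  In a wK4 model the points of a cluster see the same points
-- strictly above it, and the types in a cluster depend only on the colours of
-- its points (and on which of these colours are joined by an edge) and on the
-- set of types occurring strictly above: a test set for a fixed point can be
-- chosen to be the fixed point itself above the cluster and a union of colours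
-- inside it.
--
-- The set of types above a point shrinks Alike-map ≺.  By induction on a list S of
-- types, "all types above w lie in S" is first-order: it says of every point
-- above w that it has a type in S on the assumption that all types above it lie
-- in S, and this conditional type is determined by the cluster and by the
-- formulas for smaller lists.  Converse well-foundedness of ≺ discharges the
-- assumption.  With S the list of all types, the type of a point is definable.

module Submission where

open import Defs
open import Axiom.ExcludedMiddle using (ExcludedMiddle)
open import Data.Bool.Base using (Bool; true; false; T)
import Data.Bool.Properties as Bool
open import Data.Empty using (⊥-elim)
open import Data.Fin.Base using (Fin; zero; suc; toℕ)
open import Data.Fin.Properties using (pigeonhole)
open import Data.List.Base as List using (List; []; _∷_; length; filter; cartesianProductWith; allFin)
open import Data.List.Membership.Propositional using (_∈_)
open import Data.List.Membership.Propositional.Properties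
  using (∈-filter⁺; ∈-++⁺ˡ; ∈-++⁺ʳ; ∈-allFin; ∈-cartesianProductWith⁺)
open import Data.List.Properties using (filter-notAll)
open import Data.List.Relation.Unary.All as All using (All; []; _∷_)
open import Data.List.Relation.Unary.All.Properties using (++⁻ˡ; ++⁻ʳ)
open import Data.List.Relation.Unary.Any as Any using (here; there; index)
open import Data.List.Relation.Unary.Any.Properties using (lookup-index)
open import Data.Nat.Base using (ℕ; zero; suc; _+_; _<_; _<′_; <′-base; ≤′-step; s≤s)
open import Data.Nat.Properties using (<⇒<′; ≤-refl; <-≤-trans)
open import Data.Product.Base using (∃; ∃₂; _×_; _,_; proj₁; proj₂; map₂; swap)
open import Data.Sum.Base as Sum using (_⊎_; inj₁; inj₂)
open import Data.Unit.Polymorphic.Base using (⊤; tt)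
open import Data.Vec.Base as Vec using (Vec; []; _∷_; _++_)
open import Data.Vec.Functional using (Vector) renaming ([] to []ᶠ; _∷_ to _∷ᶠ_)
open import Data.Vec.Properties using (≡-dec; lookup∘tabulate; ∷-injectiveˡ; ∷-injectiveʳ; ++-injectiveˡ; ++-injectiveʳ)
open import Function.Base using (flip; _∘_; id; case_of_)
open import Function.Bundles using (_⇔_; mk⇔; Equivalence; Inverse)
open import Function.Construct.Composition using (_⇔-∘_)
open import Function.Construct.Identity using (⇔-id)
open import Function.Construct.Symmetry using (⇔-sym)
open import Induction.WellFounded using (WellFounded; Acc; acc)
open import Level using (Level; 0ℓ; Lift; lift; lower; _⊔_) renaming (suc to lsuc)
open import Relation.Binary.Core using (Rel; REL)
open import Relation.Binary.PropositionalEquality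
  using (_≡_; _≢_; refl; sym; trans; cong; cong₂; subst)
open import Relation.Nullary.Decidable.Core using (Dec; yes; no; ⌊_⌋; toWitness; fromWitness)
open import Relation.Nullary.Decidable using (map′; ¬?)
open import Relation.Nullary.Negation.Core using (¬_; contradiction)
open import Relation.Unary using (Pred; _⊆_)

open Equivalence using (to; from)
open IsBisimulation

private
  variable
    a : Level
    A : Set a
    P : Set
    n : ℕ

-- Bisimulation invariance of the μ-calculus.

converse : ∀ {M N : Model P} {ι} → IsBisimulation M N ι → IsBisimulation N M (flip ι)
converse bis .atoms r p   = ⇔-sym (bis .atoms r p)
converse bis .forth r v⊏v = bis .back r v⊏v
converse bis .back  r u⊏u = bis .forth r u⊏u

-- Variables occur only positively, so an inclusion between the valuations along `ι` suffices. The
-- other direction comes from `converse`, and monotonicity is the case of an identity relation.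
⟦⟧-bisim : ∀ {M N : Model P} {ι} → IsBisimulation M N ι →
           (φ : Formula P n) → ∀ {ρ σ} → (∀ x {u v} → ι u v → ρ x u → σ x v) →
           ∀ {u v} → ι u v → ⟦_⟧ M φ ρ u → ⟦_⟧ N φ σ v
⟦⟧-bisim bis tt′      c r _        = tt
⟦⟧-bisim bis (var x)  c r (lift h) = lift (c x r h)
⟦⟧-bisim bis (con p)  c r (lift h) = lift (bis .atoms r p .to h)
⟦⟧-bisim bis (¬con p) c r (lift h) = lift (h ∘ bis .atoms r p .from)
⟦⟧-bisim bis (φ ∧′ ψ) c r (h , k)  = ⟦⟧-bisim bis φ c r h , ⟦⟧-bisim bis ψ c r k
⟦⟧-bisim bis (φ ∨′ ψ) c r          = Sum.map (⟦⟧-bisim bis φ c r) (⟦⟧-bisim bis ψ c r)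
⟦⟧-bisim bis (◇ φ)    c r (u′ , u⊏u′ , h) =
  let v′ , v⊏v′ , r′ = bis .forth r u⊏u′ in v′ , v⊏v′ , ⟦⟧-bisim bis φ c r′ h
⟦⟧-bisim bis (□ φ)    c r h v′ v⊏v′ =
  let u′ , u⊏u′ , r′ = bis .back r v⊏v′ in ⟦⟧-bisim bis φ c r′ (h u′ u⊏u′)
⟦⟧-bisim {ι = ι} bis (ν φ) {σ = σ} c {v = v} r (S , S⊆ , Su) =
  -- The image of a post-fixed point under `ι` is again post-fixed.
  (λ v → ∃ λ u → ι u v × S u) ,
  (λ (u , r , Su) → ⟦⟧-bisim bis φ (λ { zero r Su → _ , r , Su ; (suc x) → c x }) r (S⊆ Su)) ,
  _ , r , Su
⟦⟧-bisim {ι = ι} bis (μ φ) c r h S ⊆S =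
  -- The largest set whose image under `ι` lies in `S`; it is pre-fixed because `S` is.
  h (λ u → ∀ v → ι u v → S v)
    (λ φu v r → ⊆S (⟦⟧-bisim bis φ (λ { zero r Su → Su _ r ; (suc x) → c x }) r φu))
    _ r

-- Valued models and the locality of truth.

record Valued (P : Set) (n : ℕ) : Set₁ where
  constructor valued
  field
    model : Model P
    wk4   : WK4 model
    value : Vector (Pred (Model.Carrier model) 0ℓ) n
  open Model model public

open Valued hiding (_⊏_; _≺_; ‖_‖)

infixl 5 _▸_
_▸_ : (V : Valued P n) → Pred (Carrier V) 0ℓ → Valued P (suc n)
V ▸ S = valued (V .model) (V .wk4) (S ∷ᶠ V .value)

infix 4 _∋_⊩_
_∋_⊩_ : (V : Valued P n) → Carrier V → Formula P n → Set₁
V ∋ w ⊩ φ = ⟦_⟧ (V .model) φ (V .value) w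

record Bisimulation (V W : Valued P n) (ι : REL (Carrier V) (Carrier W) 0ℓ) : Set where
  field
    isBisimulation : IsBisimulation (V .model) (W .model) ι
    values         : ∀ x {u v} → ι u v → V .value x u ⇔ W .value x v

open Bisimulation

module _ {V W : Valued P n} {ι : REL (Carrier V) (Carrier W) 0ℓ} (bis : Bisimulation V W ι) where

  ⊩-bisim : ∀ φ {u v} → ι u v → V ∋ u ⊩ φ ⇔ W ∋ v ⊩ φ
  ⊩-bisim φ r = mk⇔
    (⟦⟧-bisim (bis .isBisimulation) φ (λ x r → bis .values x r .to) r)
    (⟦⟧-bisim (converse (bis .isBisimulation)) φ (λ x r → bis .values x r .from) r)

  ▸-bisim : ∀ {S S′} → (∀ {u v} → ι u v → S u ⇔ S′ v) → Bisimulation (V ▸ S) (W ▸ S′) ι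
  ▸-bisim S⇔S′ .isBisimulation    = bis .isBisimulation
  ▸-bisim S⇔S′ .values zero    r = S⇔S′ r
  ▸-bisim S⇔S′ .values (suc x) r = bis .values x r

IsUpset : (M : Model P) → Pred (Model.Carrier M) 0ℓ → Set
IsUpset M U = ∀ {u v} → U u → Model._⊏_ M u v → U v

-- Successors never leave an upset, so truth at its points is that of the generated submodel.
upset-bisim : ∀ {M : Model P} {U} → IsUpset M U → IsBisimulation M M (λ u v → u ≡ v × U u)
upset-bisim up .atoms (refl , Uu) p    = ⇔-id _
upset-bisim up .forth (refl , Uu) u⊏u′ = _ , u⊏u′ , refl , up Uu u⊏u′
upset-bisim up .back  (refl , Uu) u⊏u′ = _ , u⊏u′ , refl , up Uu u⊏u′

module _ {V : Valued P n} where

  -- Allows a test set to be changed in and below a cluster without any effect on the points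
  -- strictly above it.
  ▸-local-bisim : ∀ {U S S′} → IsUpset (V .model) U → (∀ {u} → U u → S u ⇔ S′ u) →
                  Bisimulation (V ▸ S) (V ▸ S′) (λ u v → u ≡ v × U u)
  ▸-local-bisim up S⇔S′ .isBisimulation             = upset-bisim up
  ▸-local-bisim up S⇔S′ .values zero    (refl , Uu) = S⇔S′ Uu
  ▸-local-bisim up S⇔S′ .values (suc x) (refl , Uu) = ⇔-id _

  ▸-mono : ∀ {S S′} φ → S ⊆ S′ → ∀ {w} → V ▸ S ∋ w ⊩ φ → V ▸ S′ ∋ w ⊩ φ
  ▸-mono {S} {S′} φ S⊆S′ =
    ⟦⟧-bisim (upset-bisim {U = λ _ → ⊤} _) φ
      (λ { zero (refl , _) → S⊆S′ ; (suc x) (refl , _) → id }) (refl , _)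

size : Formula P n → ℕ
size tt′      = 1
size (var x)  = 1
size (con p)  = 1
size (¬con p) = 1
size (φ ∧′ ψ) = suc (size φ + size ψ)
size (φ ∨′ ψ) = suc (size φ + size ψ)
size (◇ φ)    = suc (size φ)
size (□ φ)    = suc (size φ)
size (ν φ)    = suc (size φ)
size (μ φ)    = suc (size φ)

-- Types and clusters

module Types (em : ExcludedMiddle (lsuc 0ℓ)) where

  em₀ : ExcludedMiddle 0ℓ
  em₀ = map′ lower lift (em {Lift _ _})

  ⟨_⟩ : Set₁ → Bool
  ⟨ A ⟩ = ⌊ em {A} ⌋

  ⟨⟩⁺ : ∀ {A} → A → T ⟨ A ⟩
  ⟨⟩⁺ {A} = fromWitness {a? = em {A}}

  ⟨⟩⁻ : ∀ {A} → T ⟨ A ⟩ → A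
  ⟨⟩⁻ {A} = toWitness {a? = em {A}}

  ⟨⟩-cong : ∀ {A B} → A ⇔ B → ⟨ A ⟩ ≡ ⟨ B ⟩
  ⟨⟩-cong {A} {B} A⇔B with em {A} | em {B}
  ... | yes _ | yes _ = refl
  ... | no  _ | no  _ = refl
  ... | yes a | no ¬b = contradiction (A⇔B .to a) ¬b
  ... | no ¬a | yes b = contradiction (A⇔B .from b) ¬a

  ⟨⟩-reflect : ∀ {A B} → ⟨ A ⟩ ≡ ⟨ B ⟩ → A → B
  ⟨⟩-reflect eq = ⟨⟩⁻ ∘ subst T eq ∘ ⟨⟩⁺

  -- Truth sets lie in `Set₁`; the passage through `Bool` gives an equivalent predicate in `Set`,
  -- which can be the value of a variable.
  ext : (φ : Formula P n) (V : Valued P n) → Pred (Carrier V) 0ℓ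
  ext φ V w = T ⟨ V ∋ w ⊩ φ ⟩

  type : (φ : Formula P n) (V : Valued P n) → Carrier V → Vec Bool (size φ)
  type tt′      V w = ⟨ V ∋ w ⊩ tt′    ⟩ ∷ []
  type (var x)  V w = ⟨ V ∋ w ⊩ var x  ⟩ ∷ []
  type (con p)  V w = ⟨ V ∋ w ⊩ con p  ⟩ ∷ []
  type (¬con p) V w = ⟨ V ∋ w ⊩ ¬con p ⟩ ∷ []
  type (φ ∧′ ψ) V w = ⟨ V ∋ w ⊩ φ ∧′ ψ ⟩ ∷ type φ V w ++ type ψ V w
  type (φ ∨′ ψ) V w = ⟨ V ∋ w ⊩ φ ∨′ ψ ⟩ ∷ type φ V w ++ type ψ V w
  type (◇ φ)    V w = ⟨ V ∋ w ⊩ ◇ φ ⟩ ∷ type φ V w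
  type (□ φ)    V w = ⟨ V ∋ w ⊩ □ φ ⟩ ∷ type φ V w
  type (ν φ)    V w = ⟨ V ∋ w ⊩ ν φ ⟩ ∷ type φ (V ▸ ext (ν φ) V) w
  type (μ φ)    V w = ⟨ V ∋ w ⊩ μ φ ⟩ ∷ type φ (V ▸ ext (μ φ) V) w

  -- Every clause of `type` puts the truth value of the whole formula first; the case split only
  -- exposes this head.
  type-truth : ∀ (φ : Formula P n) {V W : Valued P n} {v w} →
               type φ V v ≡ type φ W w → V ∋ v ⊩ φ → W ∋ w ⊩ φ
  type-truth tt′      = ⟨⟩-reflect ∘ ∷-injectiveˡ
  type-truth (var x)  = ⟨⟩-reflect ∘ ∷-injectiveˡ
  type-truth (con p)  = ⟨⟩-reflect ∘ ∷-injectiveˡ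
  type-truth (¬con p) = ⟨⟩-reflect ∘ ∷-injectiveˡ
  type-truth (φ ∧′ ψ) = ⟨⟩-reflect ∘ ∷-injectiveˡ
  type-truth (φ ∨′ ψ) = ⟨⟩-reflect ∘ ∷-injectiveˡ
  type-truth (◇ φ)    = ⟨⟩-reflect ∘ ∷-injectiveˡ
  type-truth (□ φ)    = ⟨⟩-reflect ∘ ∷-injectiveˡ
  type-truth (ν φ)    = ⟨⟩-reflect ∘ ∷-injectiveˡ
  type-truth (μ φ)    = ⟨⟩-reflect ∘ ∷-injectiveˡ

  ext-cong : ∀ (φ : Formula P n) {V W : Valued P n} {v w} →
             V ∋ v ⊩ φ ⇔ W ∋ w ⊩ φ → ext φ V v ⇔ ext φ W w
  ext-cong φ h = mk⇔ (⟨⟩⁺ ∘ h .to ∘ ⟨⟩⁻) (⟨⟩⁺ ∘ h .from ∘ ⟨⟩⁻)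

  -- Under a binder the induction continues because the fixed points are themselves bisimulation
  -- invariant, so the extended models stay bisimilar.
  type-bisim : ∀ (φ : Formula P n) {V W : Valued P n} {ι} → Bisimulation V W ι →
               ∀ {u v} → ι u v → type φ V u ≡ type φ W v
  type-bisim tt′        bis r = refl
  type-bisim φ@(var x)  bis r = cong (_∷ []) (⟨⟩-cong (⊩-bisim bis φ r))
  type-bisim φ@(con p)  bis r = cong (_∷ []) (⟨⟩-cong (⊩-bisim bis φ r))
  type-bisim φ@(¬con p) bis r = cong (_∷ []) (⟨⟩-cong (⊩-bisim bis φ r))
  type-bisim χ@(φ ∧′ ψ) bis r = cong₂ _∷_ (⟨⟩-cong (⊩-bisim bis χ r))
    (cong₂ _++_ (type-bisim φ bis r) (type-bisim ψ bis r))
  type-bisim χ@(φ ∨′ ψ) bis r = cong₂ _∷_ (⟨⟩-cong (⊩-bisim bis χ r))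
    (cong₂ _++_ (type-bisim φ bis r) (type-bisim ψ bis r))
  type-bisim χ@(◇ φ)    bis r = cong₂ _∷_ (⟨⟩-cong (⊩-bisim bis χ r)) (type-bisim φ bis r)
  type-bisim χ@(□ φ)    bis r = cong₂ _∷_ (⟨⟩-cong (⊩-bisim bis χ r)) (type-bisim φ bis r)
  type-bisim χ@(ν φ) {V} {W} bis r = cong₂ _∷_ (⟨⟩-cong (⊩-bisim bis χ r))
    (type-bisim φ (▸-bisim bis (λ r → ext-cong χ {V} {W} (⊩-bisim bis χ r))) r)
  type-bisim χ@(μ φ) {V} {W} bis r = cong₂ _∷_ (⟨⟩-cong (⊩-bisim bis χ r))
    (type-bisim φ (▸-bisim bis (λ r → ext-cong χ {V} {W} (⊩-bisim bis χ r))) r)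

  -- Half of Knaster-Tarski: the least fixed point lies in each pre-fixed `S`, so by monotonicity
  -- its image under the body lies in `S` too.
  ext-μ-prefixed : ∀ {V : Valued P n} {φ w} → V ▸ ext (μ φ) V ∋ w ⊩ φ → ext (μ φ) V w
  ext-μ-prefixed {V = V} {φ} h = ⟨⟩⁺ {V ∋ _ ⊩ μ φ} λ S pre →
    pre (▸-mono {V = V} φ (λ Xw → ⟨⟩⁻ {V ∋ _ ⊩ μ φ} Xw S pre) h)

  ext-ν-postfixed : ∀ {V : Valued P n} {φ w} → ext (ν φ) V w → V ▸ ext (ν φ) V ∋ w ⊩ φ
  ext-ν-postfixed {V = V} {φ} Xw =
    let S , post , Sw = ⟨⟩⁻ {V ∋ _ ⊩ ν φ} Xw in
    ▸-mono {V = V} φ (λ Sv → ⟨⟩⁺ {V ∋ _ ⊩ ν φ} (S , post , Sv)) (post Sw)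

  -- Colours and clusters.

  -- Equality of colours, where the colour of a point consists of the constants and free variables
  -- true at it.
  record Same (V W : Valued P n) (v : Carrier V) (w : Carrier W) : Set where
    constructor same
    field
      atoms  : ∀ p → Valued.‖_‖ V p v ⇔ Valued.‖_‖ W p w
      values : ∀ x → V .value x v ⇔ W .value x w

  open Same

  module _ {V W : Valued P n} where

    Same-sym : ∀ {v w} → Same V W v w → Same W V w v
    Same-sym (same h k) = same (⇔-sym ∘ h) (⇔-sym ∘ k)

    Same-trans : ∀ {U : Valued P n} {u v w} → Same U V u v → Same V W v w → Same U W u w
    Same-trans (same h k) (same h′ k′) = same (λ p → h′ p ⇔-∘ h p) (λ x → k′ x ⇔-∘ k x)

  Same-refl : ∀ {V : Valued P n} {v} → Same V V v v
  Same-refl = same (λ _ → ⇔-id _) (λ _ → ⇔-id _)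

  -- `centre` puts `w` into its own cluster even when `w` is irreflexive.
  data Cl (M : Model P) (w : Model.Carrier M) : Pred (Model.Carrier M) 0ℓ where
    centre : Cl M w w
    clique : ∀ {v} → Model._⊏_ M w v → Model._⊏_ M v w → Cl M w v

  ≺-¬Cl : ∀ {M : Model P} {w v} → Model._≺_ M w v → ¬ Cl M w v
  ≺-¬Cl (w⊏v , ¬v⊏w) centre         = ¬v⊏w w⊏v
  ≺-¬Cl (w⊏v , ¬v⊏w) (clique _ v⊏w) = ¬v⊏w v⊏w

  module Clusters (M : Model P) (wk4 : WK4 M) where
    open Model M using (_⊏_; _≺_)

    Cl-⊏ : ∀ {w u v} → Cl M w u → Cl M w v → u ≢ v → u ⊏ v
    Cl-⊏ centre         centre         u≢v = contradiction refl u≢v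
    Cl-⊏ centre         (clique w⊏v _) u≢v = w⊏v
    Cl-⊏ (clique _ u⊏w) centre         u≢v = u⊏w
    Cl-⊏ (clique _ u⊏w) (clique w⊏v _) u≢v = wk4 u≢v u⊏w w⊏v

    Cl-≺ : ∀ {w v u} → Cl M w v → w ≺ u → v ⊏ u
    Cl-≺ centre           (w⊏u , _)       = w⊏u
    Cl-≺ c@(clique _ v⊏w) w≺u@(w⊏u , _) = wk4 (λ { refl → ≺-¬Cl w≺u c }) v⊏w w⊏u

    -- Weak transitivity applies because `¬ v ⊏ w` keeps the end points distinct. In particular `≺`
    -- is transitive.
    ≺-upset : ∀ {w} → IsUpset M (w ≺_)
    ≺-upset w≺v@(w⊏v , ¬v⊏w) v⊏u =
      wk4 (λ { refl → ¬v⊏w v⊏u }) w⊏v v⊏u ,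
      λ u⊏w → ¬v⊏w (wk4 (λ { refl → ¬v⊏w w⊏v }) v⊏u u⊏w)

    Cl-sees : ∀ {w v u} → Cl M w v → v ⊏ u → w ≢ u → w ⊏ u
    Cl-sees centre         v⊏u w≢u = v⊏u
    Cl-sees (clique w⊏v _) v⊏u w≢u = wk4 w≢u w⊏v v⊏u

    -- The case split behind every modal step: successors in the cluster are matched by colour,
    -- those strictly above by type.
    Cl-step : ∀ {w v u} → Cl M w v → v ⊏ u → Cl M w u ⊎ w ≺ u
    Cl-step {w} {v} {u} c v⊏u with em₀ {w ≡ u} | em₀ {u ⊏ w}
    ... | yes refl | _       = inj₁ centre
    ... | no  w≢u  | yes u⊏w = inj₁ (clique (Cl-sees c v⊏u w≢u) u⊏w)
    ... | no  w≢u  | no ¬u⊏w = inj₂ (Cl-sees c v⊏u w≢u , ¬u⊏w)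

  -- Edges are recorded only within a colour, since points of different colours are distinct and see
  -- each other by weak transitivity. Such an edge means that the colour has a reflexive point or
  -- two points in the cluster.
  record Embeds (V W : Valued P n) (w : Carrier V) (w′ : Carrier W) : Set where
    open Valued V using () renaming (_⊏_ to _⊏ⱽ_)
    open Valued W using () renaming (_⊏_ to _⊏ᵂ_)
    field
      point : ∀ {v} → Cl (V .model) w v → ∃ λ v′ → Cl (W .model) w′ v′ × Same V W v v′
      edge  : ∀ {u v} → Cl (V .model) w u → Cl (V .model) w v → u ⊏ⱽ v → Same V V u v →
              ∃₂ λ u′ v′ → Cl (W .model) w′ u′ × Cl (W .model) w′ v′ × u′ ⊏ᵂ v′ × Same V W u u′ × Same V W v v′

  open Embeds

  Matching : (V W : Valued P n) → Carrier V → Carrier W → Set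
  Matching V W w w′ = Embeds V W w w′ × Embeds W V w′ w

  Embeds-refl : ∀ {V : Valued P n} {w} → Embeds V V w w
  Embeds-refl .point c = _ , c , Same-refl
  Embeds-refl .edge  c d u⊏v _ =
    _ , _ , c , d , u⊏v , Same-refl , Same-refl

  Same-▸ : ∀ {V W : Valued P n} {S S′ v w} → S v ⇔ S′ w → Same V W v w → Same (V ▸ S) (W ▸ S′) v w
  Same-▸ h (same k l) = same k λ { zero → h ; (suc x) → l x }

  Same-▸⁻ : ∀ {V W : Valued P n} {S S′ v w} → Same (V ▸ S) (W ▸ S′) v w → Same V W v w
  Same-▸⁻ (same k l) = same k (l ∘ suc)

  module _ {V W : Valued P n} {w : Carrier V} {w′ : Carrier W} where
    open Valued V using () renaming (_⊏_ to _⊏ⱽ_; _≺_ to _≺ⱽ_)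
    open Valued W using () renaming (_⊏_ to _⊏ᵂ_; _≺_ to _≺ᵂ_)

    -- A new variable only refines colours, so an edge within a new colour is one within an old
    -- colour, and the hypothesis carries the new value across.
    Embeds-▸ : ∀ {S S′} →
               (∀ {v v′} → Cl (V .model) w v → Cl (W .model) w′ v′ → Same V W v v′ → S v ⇔ S′ v′) →
               Embeds V W w w′ → Embeds (V ▸ S) (W ▸ S′) w w′
    Embeds-▸ h e .point c =
      let v′ , c′ , s = e .point c in
      v′ , c′ , Same-▸ (h c c′ s) s
    Embeds-▸ h e .edge c d u⊏v s =
      let u′ , v′ , c′ , d′ , u′⊏v′ , su , sv = e .edge c d u⊏v (Same-▸⁻ s) in
      u′ , v′ , c′ , d′ , u′⊏v′ ,
      Same-▸ (h c c′ su) su , Same-▸ (h d d′ sv) sv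

    -- A point sees another of its own colour in its cluster iff some edge of
    -- the cluster joins points of that colour, by weak transitivity.
    Cl-forth : Embeds V W w w′ → ∀ {v v′ u} → Cl (V .model) w v → Cl (W .model) w′ v′ → Same V W v v′ →
               Cl (V .model) w u → v ⊏ⱽ u → ∃ λ u′ → v′ ⊏ᵂ u′ × Cl (W .model) w′ u′ × Same V W u u′
    Cl-forth e {v} {v′} {u} c c′ s d v⊏u with em₀ {Same V V v u}
    ... | no ¬vu =
      let u′ , d′ , t = e .point d in
      u′ , Clusters.Cl-⊏ (W .model) (W .wk4) c′ d′ (λ { refl → ¬vu (Same-trans s (Same-sym t)) }) , d′ , t
    ... | yes vu with e .edge c d v⊏u vu
    -- An end of this edge other than `v′` is seen from `v′`, being in the same cluster; if both
    -- ends are `v′`, the edge is a loop there.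
    ...   | x , y , cx , cy , x⊏y , sx , sy with em₀ {v′ ≡ y} | em₀ {v′ ≡ x}
    ...     | no v′≢y  | _         = y , Clusters.Cl-⊏ (W .model) (W .wk4) c′ cy v′≢y , cy , sy
    ...     | yes refl | yes refl  = y , x⊏y , cy , sy
    ...     | yes refl | no v′≢x   =
      x , Clusters.Cl-⊏ (W .model) (W .wk4) c′ cx v′≢x , cx , Same-trans (Same-sym vu) sx

  -- Points of one colour in one cluster are bisimilar.
  colour-invariant : ∀ (φ : Formula P n) {V : Valued P n} {w u v} → Cl (V .model) w u → Cl (V .model) w v → Same V V u v →
            V ∋ u ⊩ φ → V ∋ v ⊩ φ
  colour-invariant φ {V} {w} c d s = ⊩-bisim bis φ (inj₁ (c , d , s)) .to
    where
    open Valued V using (_⊏_; _≺_)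
    open Clusters (V .model) (V .wk4)

    ι : REL (Carrier V) (Carrier V) 0ℓ
    ι u v = (Cl (V .model) w u × Cl (V .model) w v × Same V V u v) ⊎ (u ≡ v × w ≺ u)

    ι-forth : ∀ {u v u′} → ι u v → u ⊏ u′ → ∃ λ v′ → v ⊏ v′ × ι u′ v′
    ι-forth (inj₁ (c , d , s)) u⊏u′ with Cl-step c u⊏u′
    ... | inj₂ w≺u′ = _ , Cl-≺ d w≺u′ , inj₂ (refl , w≺u′)
    ... | inj₁ c′   =
      let v′ , v⊏v′ , d′ , s′ = Cl-forth Embeds-refl c d s c′ u⊏u′ in
      v′ , v⊏v′ , inj₁ (c′ , d′ , s′)
    ι-forth (inj₂ (refl , w≺u)) u⊏u′ = _ , u⊏u′ , inj₂ (refl , ≺-upset w≺u u⊏u′)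

    ι-sym : ∀ {u v} → ι u v → ι v u
    ι-sym (inj₁ (c , d , s))    = inj₁ (d , c , Same-sym s)
    ι-sym (inj₂ (refl , w≺u)) = inj₂ (refl , w≺u)

    bis : Bisimulation V V ι
    bis .isBisimulation .atoms (inj₁ (_ , _ , s)) p = s .atoms p
    bis .isBisimulation .atoms (inj₂ (refl , _))  p = ⇔-id _
    bis .isBisimulation .forth = ι-forth
    bis .isBisimulation .back r v⊏v′ =
      map₂ (map₂ ι-sym) (ι-forth (ι-sym r) v⊏v′)
    bis .values x (inj₁ (_ , _ , s)) = s .values x
    bis .values x (inj₂ (refl , _))  = ⇔-id _

  -- Types are determined by the cluster and the types above it.

  Above : (φ : Formula P n) (V W : Valued P n) → Carrier V → Carrier W → Set
  Above φ V W w w′ =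
    ∀ {v} → Valued._≺_ V w v → ∃ λ v′ → Valued._≺_ W w′ v′ × type φ V v ≡ type φ W v′

  record Alike (φ : Formula P n) (V W : Valued P n) (w : Carrier V) (w′ : Carrier W) : Set where
    constructor alike
    field
      match : Matching V W w w′
      above : Above φ V W w w′ × Above φ W V w′ w

  open Alike

  Alike-sym : ∀ {φ : Formula P n} {V W w w′} → Alike φ V W w w′ → Alike φ W V w′ w
  Alike-sym (alike m a) = alike (swap m) (swap a)

  TypesAgree : (φ : Formula P n) (V W : Valued P n) → Carrier V → Carrier W → Set
  TypesAgree φ V W w w′ = ∀ {v v′} → Cl (V .model) w v → Cl (W .model) w′ v′ →
                          Same V W v v′ → type φ V v ≡ type φ W v′

  -- Quantified over all valued models, so that for the body of a fixed-point formula it applies to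
  -- any test set.
  Determined : Formula P n → Set₁
  Determined φ = ∀ {V W w w′} → Alike φ V W w w′ → TypesAgree φ V W w w′

  TypesAgree-sym : ∀ {φ : Formula P n} {V W w w′} → TypesAgree φ V W w w′ → TypesAgree φ W V w′ w
  TypesAgree-sym h c c′ s = sym (h c′ c (Same-sym s))

  module _ (φ : Formula P n) {V W : Valued P n} {w : Carrier V} {w′ : Carrier W}
           (al : Alike φ V W w w′) (agree : TypesAgree φ V W w w′) where
    open Valued V using () renaming (_⊏_ to _⊏ⱽ_)
    open Valued W using () renaming (_⊏_ to _⊏ᵂ_)

    type-forth : ∀ {v v′ u} → Cl (V .model) w v → Cl (W .model) w′ v′ → Same V W v v′ → v ⊏ⱽ u →
                 ∃ λ u′ → v′ ⊏ᵂ u′ × type φ V u ≡ type φ W u′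
    type-forth c c′ s v⊏u with Clusters.Cl-step (V .model) (V .wk4) c v⊏u
    ... | inj₁ d =
      let u′ , v′⊏u′ , d′ , t = Cl-forth (al .match .proj₁) c c′ s d v⊏u in
      u′ , v′⊏u′ , agree d d′ t
    ... | inj₂ w≺u =
      let u′ , w′≺u′ , eq = al .above .proj₁ w≺u in
      u′ , Clusters.Cl-≺ (W .model) (W .wk4) c′ w′≺u′ , eq

    ◇-transfer : ∀ {v v′} → Cl (V .model) w v → Cl (W .model) w′ v′ → Same V W v v′ →
                 V ∋ v ⊩ ◇ φ → W ∋ v′ ⊩ ◇ φ
    ◇-transfer c c′ s (u , v⊏u , h) =
      let u′ , v′⊏u′ , eq = type-forth c c′ s v⊏u in u′ , v′⊏u′ , type-truth φ eq h

    -- Runs from `W` to `V`, since each successor to be checked lies in `V` and is moved forth.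
    □-transfer : ∀ {v v′} → Cl (V .model) w v → Cl (W .model) w′ v′ → Same V W v v′ →
                 W ∋ v′ ⊩ □ φ → V ∋ v ⊩ □ φ
    □-transfer c c′ s h u v⊏u =
      let u′ , v′⊏u′ , eq = type-forth c c′ s v⊏u in type-truth φ (sym eq) (h u′ v′⊏u′)

  -- Transfer of fixed points between matching clusters.

  module Fixpoint (φ : Formula P (suc n)) (det : Determined φ) where

    module _ {V W : Valued P n} {w : Carrier V} {w′ : Carrier W} (m : Matching V W w w′)
             {X : Pred (Carrier V) 0ℓ} {X′ : Pred (Carrier W) 0ℓ}
             (above : Above φ (V ▸ X) (W ▸ X′) w w′ × Above φ (W ▸ X′) (V ▸ X) w′ w) where
      open Valued V using () renaming (_≺_ to _≺ⱽ_)
      open Valued W using () renaming (_≺_ to _≺ᵂ_)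

      -- By locality the types above the clusters are those for `X` and `X′`, which match by
      -- assumption. In the clusters the test sets respect the matching of colours, so `det`
      -- applies.
      ▸-types-agree : ∀ {S S′} →
        (∀ {u} → w ≺ⱽ u → S u ⇔ X u) → (∀ {u} → w′ ≺ᵂ u → S′ u ⇔ X′ u) →
        (∀ {v v′} → Cl (V .model) w v → Cl (W .model) w′ v′ → Same V W v v′ → S v ⇔ S′ v′) →
        ∀ {v v′} → Cl (V .model) w v → Cl (W .model) w′ v′ → Same V W v v′ →
        type φ (V ▸ S) v ≡ type φ (W ▸ S′) v′
      ▸-types-agree {S} {S′} S⇔X S′⇔X′ S⇔S′ c c′ s =
        det (alike (Embeds-▸ S⇔S′ (m .proj₁) ,
                    Embeds-▸ (λ c′ c s → ⇔-sym (S⇔S′ c c′ (Same-sym s))) (m .proj₂))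
                   (up , up′))
            c c′ (Same-▸ (S⇔S′ c c′ s) s)
        where
        local : ∀ {u} → w ≺ⱽ u → type φ (V ▸ S) u ≡ type φ (V ▸ X) u
        local w≺u =
          type-bisim φ (▸-local-bisim {V = V} (Clusters.≺-upset (V .model) (V .wk4)) S⇔X) (refl , w≺u)

        local′ : ∀ {u} → w′ ≺ᵂ u → type φ (W ▸ S′) u ≡ type φ (W ▸ X′) u
        local′ w≺u =
          type-bisim φ (▸-local-bisim {V = W} (Clusters.≺-upset (W .model) (W .wk4)) S′⇔X′) (refl , w≺u)

        up : Above φ (V ▸ S) (W ▸ S′) w w′
        up w≺v =
          let v′ , w′≺v′ , eq = above .proj₁ w≺v in
          v′ , w′≺v′ , trans (local w≺v) (trans eq (sym (local′ w′≺v′)))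

        up′ : Above φ (W ▸ S′) (V ▸ S) w′ w
        up′ w′≺v′ =
          let v , w≺v , eq = above .proj₂ w′≺v′ in
          v , w≺v , trans (local′ w′≺v′) (trans eq (sym (local w≺v)))

    module _ {V W : Valued P n} {w : Carrier V} {w′ : Carrier W} where
      open Valued V using () renaming (_≺_ to _≺ⱽ_)
      open Valued W using () renaming (_≺_ to _≺ᵂ_)

      -- In the cluster of w the test set is pulled back from the fixed point
      -- over W, above w it is the fixed point over V, elsewhere it is everything.
      μ-transfer : Matching V W w w′ →
        (let X = ext (μ φ) V; X′ = ext (μ φ) W) →
        Above φ (V ▸ X) (W ▸ X′) w w′ × Above φ (W ▸ X′) (V ▸ X) w′ w →
        ∀ {v v′} → Cl (V .model) w v → Cl (W .model) w′ v′ → Same V W v v′ → X v → X′ v′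
      μ-transfer m above {v} c c′ s Xv =
        ⟨⟩⁻ {V ∋ v ⊩ μ φ} Xv S prefixed .proj₁ _ c c′ s
        where
        X  = ext (μ φ) V
        X′ = ext (μ φ) W

        S : Pred (Carrier V) 0ℓ
        S u = (∀ u′ → Cl (V .model) w u → Cl (W .model) w′ u′ → Same V W u u′ → X′ u′) ×
              (w ≺ⱽ u → X u)

        S⇔X : ∀ {u} → w ≺ⱽ u → S u ⇔ X u
        S⇔X w≺u = mk⇔ (λ Su → Su .proj₂ w≺u) (λ Xu → (λ _ c → ⊥-elim (≺-¬Cl w≺u c)) , λ _ → Xu)

        S⇔X′ : ∀ {u u′} → Cl (V .model) w u → Cl (W .model) w′ u′ → Same V W u u′ → S u ⇔ X′ u′
        S⇔X′ c c′ s = mk⇔ (λ Su → Su .proj₁ _ c c′ s)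
          -- All partners of `u` in the cluster of `w′` have one colour, so one of them in `X′` puts
          -- all of them there.
          (λ X′u′ → (λ _ c d s′ → ⟨⟩⁺ {W ∋ _ ⊩ μ φ}
                      (colour-invariant (μ φ) c′ d (Same-trans (Same-sym s) s′) (⟨⟩⁻ {W ∋ _ ⊩ μ φ} X′u′))) ,
                    λ w≺u → ⊥-elim (≺-¬Cl w≺u c))

        prefixed : ∀ {u} → V ▸ S ∋ u ⊩ φ → S u
        -- In the cluster truth moves to `W`, where `X′` is pre-fixed; above it `S` coincides with
        -- `X`, which is pre-fixed.
        prefixed h .proj₁ _ c c′ s = ext-μ-prefixed {V = W} {φ} (type-truth φ
          (▸-types-agree m above S⇔X (λ _ → ⇔-id _) S⇔X′ c c′ s) h)
        prefixed h .proj₂ w≺u = ext-μ-prefixed {V = V} {φ} (⊩-bisim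
          (▸-local-bisim {V = V} (Clusters.≺-upset (V .model) (V .wk4)) S⇔X) φ (refl , w≺u) .to h)

      -- Dually, the test set lives over `W`: in the cluster of `w′` it is the image of the fixed
      -- point over `V`, above it the fixed point over `W`, and elsewhere empty.
      ν-transfer : Matching V W w w′ →
        (let X = ext (ν φ) V; X′ = ext (ν φ) W) →
        Above φ (V ▸ X) (W ▸ X′) w w′ × Above φ (W ▸ X′) (V ▸ X) w′ w →
        ∀ {v v′} → Cl (V .model) w v → Cl (W .model) w′ v′ → Same V W v v′ → X v → X′ v′
      ν-transfer m above {v} {v′} c c′ s Xv =
        ⟨⟩⁺ {W ∋ v′ ⊩ ν φ} (S′ , postfixed , inj₁ (_ , c , c′ , s , Xv))
        where
        X  = ext (ν φ) V
        X′ = ext (ν φ) W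

        S′ : Pred (Carrier W) 0ℓ
        S′ u′ = (∃ λ u → Cl (V .model) w u × Cl (W .model) w′ u′ × Same V W u u′ × X u) ⊎
                (w′ ≺ᵂ u′ × X′ u′)

        S′⇔X′ : ∀ {u′} → w′ ≺ᵂ u′ → S′ u′ ⇔ X′ u′
        S′⇔X′ w′≺u′ = mk⇔
          (λ { (inj₁ (_ , _ , c′ , _)) → ⊥-elim (≺-¬Cl w′≺u′ c′) ; (inj₂ (_ , X′u′)) → X′u′ })
          (λ X′u′ → inj₂ (w′≺u′ , X′u′))

        X⇔S′ : ∀ {u u′} → Cl (V .model) w u → Cl (W .model) w′ u′ → Same V W u u′ → X u ⇔ S′ u′
        X⇔S′ c c′ s = mk⇔ (λ Xu → inj₁ (_ , c , c′ , s , Xu)) λ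
          { (inj₁ (_ , d , _ , s′ , Xu)) → ⟨⟩⁺ {V ∋ _ ⊩ ν φ}
              (colour-invariant (ν φ) d c (Same-trans s′ (Same-sym s)) (⟨⟩⁻ {V ∋ _ ⊩ ν φ} Xu))
          ; (inj₂ (w′≺u′ , _)) → ⊥-elim (≺-¬Cl w′≺u′ c′) }

        postfixed : ∀ {u′} → S′ u′ → W ▸ S′ ∋ u′ ⊩ φ
        postfixed (inj₁ (_ , c , c′ , s , Xu)) = type-truth φ
          (▸-types-agree m above (λ _ → ⇔-id _) S′⇔X′ X⇔S′ c c′ s) (ext-ν-postfixed {V = V} {φ} Xu)
        postfixed (inj₂ (w′≺u′ , X′u′)) = ⊩-bisim
          (▸-local-bisim {V = W} (Clusters.≺-upset (W .model) (W .wk4)) S′⇔X′) φ (refl , w′≺u′)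
          .from (ext-ν-postfixed {V = W} {φ} X′u′)

  module _ {φ : Formula P n} {V W : Valued P n} {w : Carrier V} {w′ : Carrier W} (al : Alike φ V W w w′) where

    -- Serves to pass to an immediate subformula, whose type is a segment of the larger type.
    Alike-map : ∀ {ψ : Formula P n} → (∀ {V W : Valued P n} {v v′} → type φ V v ≡ type φ W v′ → type ψ V v ≡ type ψ W v′) →
            Alike ψ V W w w′
    Alike-map f = alike (al .match)
      ( (λ w≺v → map₂ (map₂ f) (al .above .proj₁ w≺v))
      , (λ w≺v → map₂ (map₂ f) (al .above .proj₂ w≺v)))

  -- Induction on the formula. For a fixed point, transfer in both directions makes the two fixed
  -- points agree on matched points; the type of the body then follows by taking them as test sets.
  determined : (φ : Formula P n) → Determined φ
  determined tt′      al c c′ s = refl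
  determined (var x)  al c c′ s = cong (_∷ []) (⟨⟩-cong
    (mk⇔ (lift ∘ s .values x .to ∘ lower) (lift ∘ s .values x .from ∘ lower)))
  determined (con p)  al c c′ s = cong (_∷ []) (⟨⟩-cong
    (mk⇔ (lift ∘ s .atoms p .to ∘ lower) (lift ∘ s .atoms p .from ∘ lower)))
  determined (¬con p) al c c′ s = cong (_∷ []) (⟨⟩-cong
    (mk⇔ (λ (lift h) → lift (h ∘ s .atoms p .from)) (λ (lift h) → lift (h ∘ s .atoms p .to))))
  determined (φ ∧′ ψ) al c c′ s = cong₂ _∷_
    (⟨⟩-cong (mk⇔ (λ (h , k) → type-truth φ eφ h , type-truth ψ eψ k)
                  (λ (h , k) → type-truth φ (sym eφ) h , type-truth ψ (sym eψ) k)))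
    (cong₂ _++_ eφ eψ)
    where
    eφ = determined φ (Alike-map al (λ eq → ++-injectiveˡ _ _ (∷-injectiveʳ eq))) c c′ s
    eψ = determined ψ (Alike-map al (λ eq → ++-injectiveʳ (type φ _ _) (type φ _ _) (∷-injectiveʳ eq))) c c′ s
  determined (φ ∨′ ψ) al c c′ s = cong₂ _∷_
    (⟨⟩-cong (mk⇔ (Sum.map (type-truth φ eφ) (type-truth ψ eψ))
                  (Sum.map (type-truth φ (sym eφ)) (type-truth ψ (sym eψ)))))
    (cong₂ _++_ eφ eψ)
    where
    eφ = determined φ (Alike-map al (λ eq → ++-injectiveˡ _ _ (∷-injectiveʳ eq))) c c′ s
    eψ = determined ψ (Alike-map al (λ eq → ++-injectiveʳ (type φ _ _) (type φ _ _) (∷-injectiveʳ eq))) c c′ s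
  determined (◇ φ) {V} {W} {w} {w′} al c c′ s = cong₂ _∷_
    (⟨⟩-cong (mk⇔ (◇-transfer φ alφ eq c c′ s)
                  (◇-transfer φ (Alike-sym alφ) (TypesAgree-sym {φ = φ} eq) c′ c (Same-sym s))))
    (eq c c′ s)
    where
    alφ : Alike φ V W w w′
    alφ = Alike-map al ∷-injectiveʳ
    eq : TypesAgree φ V W w w′
    eq = determined φ alφ
  determined (□ φ) {V} {W} {w} {w′} al c c′ s = cong₂ _∷_
    (⟨⟩-cong (mk⇔ (□-transfer φ (Alike-sym alφ) (TypesAgree-sym {φ = φ} eq) c′ c (Same-sym s))
                  (□-transfer φ alφ eq c c′ s)))
    (eq c c′ s)
    where
    alφ : Alike φ V W w w′
    alφ = Alike-map al ∷-injectiveʳ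
    eq : TypesAgree φ V W w w′
    eq = determined φ alφ
  determined (ν φ) {V} {W} {w} {w′} (alike m (up , up′)) c c′ s = cong₂ _∷_
    (⟨⟩-cong (mk⇔ (⟨⟩⁻ ∘ X⇔X′ c c′ s .to ∘ ⟨⟩⁺) (⟨⟩⁻ ∘ X⇔X′ c c′ s .from ∘ ⟨⟩⁺)))
    (▸-types-agree m ups (λ _ → ⇔-id _) (λ _ → ⇔-id _) X⇔X′ c c′ s)
    where
    open Fixpoint φ (determined φ)
    X  = ext (ν φ) V
    X′ = ext (ν φ) W

    ups : Above φ (V ▸ X) (W ▸ X′) w w′ × Above φ (W ▸ X′) (V ▸ X) w′ w
    ups = (λ w≺v → map₂ (map₂ ∷-injectiveʳ) (up w≺v)) , (λ w≺v → map₂ (map₂ ∷-injectiveʳ) (up′ w≺v))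

    X⇔X′ : ∀ {v v′} → Cl (V .model) w v → Cl (W .model) w′ v′ → Same V W v v′ → X v ⇔ X′ v′
    X⇔X′ c c′ s = mk⇔ (ν-transfer m ups c c′ s) (ν-transfer (swap m) (swap ups) c′ c (Same-sym s))
  determined (μ φ) {V} {W} {w} {w′} (alike m (up , up′)) c c′ s = cong₂ _∷_
    (⟨⟩-cong (mk⇔ (⟨⟩⁻ ∘ X⇔X′ c c′ s .to ∘ ⟨⟩⁺) (⟨⟩⁻ ∘ X⇔X′ c c′ s .from ∘ ⟨⟩⁺)))
    (▸-types-agree m ups (λ _ → ⇔-id _) (λ _ → ⇔-id _) X⇔X′ c c′ s)
    where
    open Fixpoint φ (determined φ)
    X  = ext (μ φ) V
    X′ = ext (μ φ) W

    ups : Above φ (V ▸ X) (W ▸ X′) w w′ × Above φ (W ▸ X′) (V ▸ X) w′ w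
    ups = (λ w≺v → map₂ (map₂ ∷-injectiveʳ) (up w≺v)) , (λ w≺v → map₂ (map₂ ∷-injectiveʳ) (up′ w≺v))

    X⇔X′ : ∀ {v v′} → Cl (V .model) w v → Cl (W .model) w′ v′ → Same V W v v′ → X v ⇔ X′ v′
    X⇔X′ c c′ s = mk⇔ (μ-transfer m ups c c′ s) (μ-transfer (swap m) (swap ups) c′ c (Same-sym s))

  -- Path-finiteness, well-foundedness and finite models.

  -- An inaccessible point has an inaccessible point strictly above it. Deciding the Σ-type returns
  -- such a point, so `next` is a function and can be iterated.
  PathFinite⇒WellFounded : ∀ {M : Model P} → PathFinite M → WellFounded (flip (Model._≺_ M))
  PathFinite⇒WellFounded {M = M} finite x with em₀ {Acc (flip (Model._≺_ M)) x}
  ... | yes a = a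
  ... | no ¬a = contradiction (proj₁ ∘ seq , λ n → next (seq n) .proj₂) finite
    where
    open Model M using (_≺_)

    Bad : Set
    Bad = ∃ λ (y : Model.Carrier M) → ¬ Acc (flip _≺_) y

    next : ((y , _) : Bad) → ∃ λ ((z , _) : Bad) → y ≺ z
    next (y , ¬a) with em₀ {∃ λ z → y ≺ z × ¬ Acc (flip _≺_) z}
    ... | yes (z , y≺z , ¬b) = (z , ¬b) , y≺z
    ... | no  ∄ = contradiction (acc λ {z} y≺z → good z y≺z) ¬a
      where
      good : ∀ z → y ≺ z → Acc (flip _≺_) z
      good z y≺z with em₀ {Acc (flip _≺_) z}
      ... | yes b = b
      ... | no ¬b = contradiction (z , y≺z , ¬b) ∄

    seq : ℕ → Bad
    seq zero    = x , ¬a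
    seq (suc n) = next (seq n) .proj₁

  -- Among the first `suc n` terms of a rising sequence two coincide, but transitivity of `≺` puts
  -- one strictly above the other.
  FiniteWK4⇒PathFiniteWK4 : ∀ {M : Model P} → FiniteWK4 M → PathFiniteWK4 M
  FiniteWK4⇒PathFiniteWK4 {M = M} (wk4 , n , iso) = wk4 , λ (f , rises) →
    let ascend : ∀ {i j} → i <′ j → f i ≺ f j
        ascend = λ i<j → chain f rises i<j
        i , j , i<j , fi≡fj = pigeonhole ≤-refl (λ (i : Fin (suc n)) → Inverse.to iso (f (toℕ i)))
        eq : f (toℕ i) ≡ f (toℕ j)
        eq = trans (sym (Inverse.strictlyInverseʳ iso _))
               (trans (cong (Inverse.from iso) fi≡fj) (Inverse.strictlyInverseʳ iso _))
    in irrefl eq (ascend (<⇒<′ i<j))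
    where
    open Model M using (_≺_)

    irrefl : ∀ {x y} → x ≡ y → ¬ x ≺ y
    irrefl refl (x⊏x , ¬x⊏x) = ¬x⊏x x⊏x

    chain : (f : ℕ → Model.Carrier M) → (∀ n → f n ≺ f (suc n)) → ∀ {i j} → i <′ j → f i ≺ f j
    chain f rises <′-base       = rises _
    chain f rises (≤′-step i<j) = Clusters.≺-upset M wk4 (chain f rises i<j) (rises _ .proj₁)

-- Reduction to finitely many constants.

reduct : ∀ {Q : Set} → (Q → P) → Model P → Model Q
reduct f M = record { Carrier = Model.Carrier M ; _⊏_ = Model._⊏_ M ; ‖_‖ = Model.‖_‖ M ∘ f }

constants : Formula P n → List P
constants tt′      = []
constants (var x)  = []
constants (con p)  = p ∷ []
constants (¬con p) = p ∷ []
constants (φ ∧′ ψ) = constants φ List.++ constants ψ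
constants (φ ∨′ ψ) = constants φ List.++ constants ψ
constants (◇ φ)    = constants φ
constants (□ φ)    = constants φ
constants (ν φ)    = constants φ
constants (μ φ)    = constants φ

-- `P` may be infinite, while there must be finitely many colours; constants are therefore replaced
-- by positions in a list.
Relabelling : List P → Formula P n → Set₁
Relabelling {P} {n} ps φ = ∃ λ (φ′ : Formula (Fin (length ps)) n) →
  ∀ (M : Model P) ρ w → ⟦_⟧ M φ ρ w ⇔ ⟦_⟧ (reduct (List.lookup ps) M) φ′ ρ w

relabel : (ps : List P) (φ : Formula P n) → (∀ {p} → p ∈ constants φ → p ∈ ps) → Relabelling ps φ
relabel ps tt′      inc = tt′ , λ M ρ w → ⇔-id _
relabel ps (var x)  inc = var x , λ M ρ w → ⇔-id _
relabel ps (con p)  inc = con (index p∈) , λ M ρ w → mk⇔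
    (λ (lift h) → lift (subst (λ q → Model.‖_‖ M q w) (lookup-index p∈) h))
    (λ (lift h) → lift (subst (λ q → Model.‖_‖ M q w) (sym (lookup-index p∈)) h))
  where p∈ = inc (here refl)
relabel ps (¬con p) inc = ¬con (index p∈) , λ M ρ w → mk⇔
    (λ (lift h) → lift (h ∘ subst (λ q → Model.‖_‖ M q w) (sym (lookup-index p∈))))
    (λ (lift h) → lift (h ∘ subst (λ q → Model.‖_‖ M q w) (lookup-index p∈)))
  where p∈ = inc (here refl)
relabel ps (φ ∧′ ψ) inc =
  let φ′ , eφ = relabel ps φ (inc ∘ ∈-++⁺ˡ) ; ψ′ , eψ = relabel ps ψ (inc ∘ ∈-++⁺ʳ (constants φ)) in
  φ′ ∧′ ψ′ , λ M ρ w → mk⇔ (λ (h , k) → eφ M ρ w .to h , eψ M ρ w .to k)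
                           (λ (h , k) → eφ M ρ w .from h , eψ M ρ w .from k)
relabel ps (φ ∨′ ψ) inc =
  let φ′ , eφ = relabel ps φ (inc ∘ ∈-++⁺ˡ) ; ψ′ , eψ = relabel ps ψ (inc ∘ ∈-++⁺ʳ (constants φ)) in
  φ′ ∨′ ψ′ , λ M ρ w → mk⇔ (Sum.map (eφ M ρ w .to) (eψ M ρ w .to))
                           (Sum.map (eφ M ρ w .from) (eψ M ρ w .from))
relabel ps (◇ φ) inc = let φ′ , e = relabel ps φ inc in ◇ φ′ , λ M ρ w → mk⇔
  (map₂ (λ {v} → map₂ (e M ρ v .to))) (map₂ (λ {v} → map₂ (e M ρ v .from)))
relabel ps (□ φ) inc = let φ′ , e = relabel ps φ inc in □ φ′ , λ M ρ w → mk⇔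
  (λ h v r → e M ρ v .to (h v r)) (λ h v r → e M ρ v .from (h v r))
relabel ps (ν φ) inc = let φ′ , e = relabel ps φ inc in ν φ′ , λ M ρ w → mk⇔
  (λ (S , post , Sw) → S , (λ {v} Sv → e M (S ∷ᶠ ρ) v .to (post Sv)) , Sw)
  (λ (S , post , Sw) → S , (λ {v} Sv → e M (S ∷ᶠ ρ) v .from (post Sv)) , Sw)
relabel ps (μ φ) inc = let φ′ , e = relabel ps φ inc in μ φ′ , λ M ρ w → mk⇔
  (λ h S pre → h S (λ {v} k → pre (e M (S ∷ᶠ ρ) v .to k)))
  (λ h S pre → h S (λ {v} k → pre (e M (S ∷ᶠ ρ) v .from k)))

-- Enumeration of colours and types.

bitvectors : ∀ m → List (Vec Bool m)
bitvectors zero    = [] ∷ []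
bitvectors (suc m) = cartesianProductWith _∷_ (true ∷ false ∷ []) (bitvectors m)

∈-bitvectors : ∀ {m} (bs : Vec Bool m) → bs ∈ bitvectors m
∈-bitvectors []           = here refl
∈-bitvectors (true  ∷ bs) = ∈-cartesianProductWith⁺ _∷_ {xs = true ∷ false ∷ []} (here refl) (∈-bitvectors bs)
∈-bitvectors (false ∷ bs) = ∈-cartesianProductWith⁺ _∷_ {xs = true ∷ false ∷ []} (there (here refl)) (∈-bitvectors bs)

-- First-order definability

record Pointed (P : Set) : Set₁ where
  constructor pointed
  field
    model : Model P
    class : PathFiniteWK4 model
    point : Model.Carrier model

open Pointed

-- The formula is given for each context and each position of its variable, which avoids renaming
-- under quantifiers.
record Definable {ℓ} (Q : Pred (Pointed P) ℓ) : Set (lsuc 0ℓ ⊔ ℓ) where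
  field
    formula : ∀ {n} → Fin n → FO P n
    correct : ∀ {M c n} (e : Vector (Model.Carrier M) n) i → Q (pointed M c (e i)) ⇔ Sat M (formula i) e

open Definable

Properties : Set → Set₁
Properties P = List (∃ λ (Q : Pred (Pointed P) 0ℓ) → Definable Q)

Agree : Properties P → Rel (Pointed P) (lsuc 0ℓ)
Agree Λ x y = All (λ (Q , _) → Q x ⇔ Q y) Λ

Agree-refl : ∀ {Λ : Properties P} {x} → Agree Λ x x
Agree-refl = All.universal (λ _ → ⇔-id _) _

Agree-sym : ∀ {Λ : Properties P} {x y} → Agree Λ x y → Agree Λ y x
Agree-sym = All.map ⇔-sym

Agree-trans : ∀ {Λ : Properties P} {x y z} → Agree Λ x y → Agree Λ y z → Agree Λ x z
Agree-trans h k = All.zipWith (λ (h , k) → k ⇔-∘ h) (h , k)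

-- `R` holds between points that finitely many definable properties fail to separate. Such relations
-- combine by concatenating lists, and `define` turns the lists back into formulas.
Controlled : ∀ {ℓ} → Rel (Pointed P) ℓ → Set (lsuc 0ℓ ⊔ ℓ)
Controlled {P} R = ∃ λ (Λ : Properties P) → ∀ {x y} → Agree Λ x y → R x y

controlled-⇔ : ∀ {Q : Pred (Pointed P) 0ℓ} → Definable Q → Controlled (λ x y → Q x ⇔ Q y)
controlled-⇔ δ = (_ , δ) ∷ [] , λ { (h ∷ []) → h }

controlled-× : ∀ {r s} {R : Rel (Pointed P) r} {S : Rel (Pointed P) s} →
               Controlled R → Controlled S → Controlled (λ x y → R x y × S x y)
controlled-× (Λ , h) (Λ′ , k) = Λ List.++ Λ′ , λ ag → h (++⁻ˡ Λ ag) , k (++⁻ʳ Λ ag)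

controlled-flip : ∀ {r} {R : Rel (Pointed P) r} → Controlled R → Controlled (flip R)
controlled-flip (Λ , h) = Λ , h ∘ Agree-sym

controlled-∀∈ : ∀ {r} (as : List A) {R : A → Rel (Pointed P) r} → (∀ {a} → a ∈ as → Controlled (R a)) →
                Controlled (λ x y → ∀ {a} → a ∈ as → R a x y)
controlled-∀∈ []       h = [] , λ _ ()
controlled-∀∈ (a ∷ as) h =
  let Λ , k = h (here refl) ; Λ′ , l = controlled-∀∈ as (h ∘ there) in
  Λ List.++ Λ′ , λ ag → λ { (here refl) → k (++⁻ˡ Λ ag) ; (there a∈) → l (++⁻ʳ Λ ag) a∈ }

module Definability (em : ExcludedMiddle (lsuc 0ℓ)) where
  open Types em

  -- A property that respects agreement on `Λ` is a Boolean combination of the members of `Λ`, found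
  -- by splitting on them one at a time.
  define : ∀ (Λ : Properties P) {Q : Pred (Pointed P) (lsuc 0ℓ)} →
           (∀ {x y} → Agree Λ x y → Q x → Q y) → Definable Q
  define [] {Q} inv with em {∃ Q}
  -- Agreement on the empty list is vacuous, so `Q` holds everywhere or nowhere; `i ≐ i` expresses
  -- truth.
  ... | yes (x , Qx) = record
    { formula = λ i → i ≐ i ; correct = λ e i → mk⇔ (λ _ → refl) (λ _ → inv [] Qx) }
  ... | no ∄ = record
    { formula = λ i → ¬′ (i ≐ i)
    ; correct = λ e i → mk⇔ (λ Qx → contradiction (_ , Qx) ∄) (λ h → contradiction refl h) }
  define {P} ((D , δ) ∷ Λ) {Q} inv = record
    { formula = λ i → (δ .formula i ∧′ δ⁺ .formula i) ∨′ ((¬′ δ .formula i) ∧′ δ⁻ .formula i)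
    ; correct = λ e i → mk⇔ (split e i) (join e i) }
    where
    Q⁺ Q⁻ : Pred (Pointed P) (lsuc 0ℓ)
    -- Quantifying over some `y` that decides `D` in a fixed way makes the property depend on `Λ`
    -- alone.
    Q⁺ x = ∃ λ y → D y × Q y × Agree Λ x y
    Q⁻ x = ∃ λ y → ¬ D y × Q y × Agree Λ x y

    δ⁺ : Definable Q⁺
    δ⁺ = define Λ λ ag (y , Dy , Qy , ag′) → y , Dy , Qy , Agree-trans (Agree-sym ag) ag′

    δ⁻ : Definable Q⁻
    δ⁻ = define Λ λ ag (y , ¬Dy , Qy , ag′) → y , ¬Dy , Qy , Agree-trans (Agree-sym ag) ag′

    split : ∀ {M c n} (e : Vector (Model.Carrier M) n) i → Q (pointed M c (e i)) →
            Sat M ((δ .formula i ∧′ δ⁺ .formula i) ∨′ ((¬′ δ .formula i) ∧′ δ⁻ .formula i)) e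
    split {M} {c} e i Qx with em₀ {D (pointed M c (e i))}
    ... | yes Dx = inj₁ (δ .correct e i .to Dx ,
                         δ⁺ .correct e i .to (_ , Dx , Qx , Agree-refl))
    ... | no ¬Dx = inj₂ (¬Dx ∘ δ .correct e i .from ,
                         δ⁻ .correct e i .to (_ , ¬Dx , Qx , Agree-refl))

    join : ∀ {M c n} (e : Vector (Model.Carrier M) n) i →
           Sat M ((δ .formula i ∧′ δ⁺ .formula i) ∨′ ((¬′ δ .formula i) ∧′ δ⁻ .formula i)) e →
           Q (pointed M c (e i))
    join {M} {c} e i (inj₁ (s , s⁺)) =
      let y , Dy , Qy , ag = δ⁺ .correct {c = c} e i .from s⁺ in
      inv (mk⇔ (λ _ → δ .correct e i .from s) (λ _ → Dy) ∷ Agree-sym ag) Qy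
    join {M} {c} e i (inj₂ (¬s , s⁻)) =
      let y , ¬Dy , Qy , ag = δ⁻ .correct {c = c} e i .from s⁻ in
      inv (mk⇔ (λ Dy → contradiction Dy ¬Dy)
               (λ Dx → contradiction (δ .correct e i .to Dx) ¬s) ∷ Agree-sym ag) Qy

  -- First-order description of a cluster.

  module _ {k} (f : Fin k → P) where

    HasColour : Vec Bool k → (M : Model P) → Pred (Model.Carrier M) 0ℓ
    HasColour c M v = ∀ p → Model.‖_‖ M (f p) v ⇔ T (Vec.lookup c p)

    colourOf : (M : Model P) → Model.Carrier M → Vec Bool k
    colourOf M v = Vec.tabulate λ p → ⌊ em₀ {Model.‖_‖ M (f p) v} ⌋

    colourOf-correct : ∀ M v → HasColour (colourOf M v) M v
    colourOf-correct M v p = mk⇔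
      (subst T (sym (lookup∘tabulate _ p)) ∘ fromWitness)
      (toWitness ∘ subst T (lookup∘tabulate _ p))

    literal : Bool → Fin k → Fin n → FO P n
    literal true  p i = pred (f p) i
    literal false p i = ¬′ pred (f p) i

    colour : Vec Bool k → List (Fin k) → Fin n → FO P n
    colour c []       i = i ≐ i
    colour c (p ∷ ps) i = literal (Vec.lookup c p) p i ∧′ colour c ps i

    module _ (M : Model P) (e : Vector (Model.Carrier M) n) (i : Fin n) where

      literal⁺ : ∀ b p → Model.‖_‖ M (f p) (e i) ⇔ T b → Sat M (literal b p i) e
      literal⁺ true  p h = h .from _
      literal⁺ false p h = h .to

      literal⁻ : ∀ b p → Sat M (literal b p i) e → Model.‖_‖ M (f p) (e i) ⇔ T b
      literal⁻ true  p h = mk⇔ (λ _ → _) (λ _ → h)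
      literal⁻ false p h = mk⇔ h ⊥-elim

      colour⁺ : ∀ c ps → HasColour c M (e i) → Sat M (colour c ps i) e
      colour⁺ c []       h = refl
      colour⁺ c (p ∷ ps) h = literal⁺ (Vec.lookup c p) p (h p) , colour⁺ c ps h

      colour⁻ : ∀ c ps → Sat M (colour c ps i) e → ∀ {p} → p ∈ ps →
                Model.‖_‖ M (f p) (e i) ⇔ T (Vec.lookup c p)
      colour⁻ c (p ∷ ps) (s , _) (here refl) = literal⁻ (Vec.lookup c p) p s
      colour⁻ c (p ∷ ps) (_ , s) (there p∈)  = colour⁻ c ps s p∈

      colour-correct : ∀ c → HasColour c M (e i) ⇔ Sat M (colour c (allFin k) i) e
      colour-correct c = mk⇔ (colour⁺ c (allFin k)) (λ s p → colour⁻ c (allFin k) s (∈-allFin p))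

    cluster : Fin n → Fin n → FO P n
    cluster i j = (i ≐ j) ∨′ ((i ⊏′ j) ∧′ (j ⊏′ i))

    cluster-correct : ∀ (M : Model P) (e : Vector (Model.Carrier M) n) i j →
                      Cl (reduct f M) (e i) (e j) ⇔ Sat M (cluster i j) e
    cluster-correct M e i j = mk⇔ (cl⁺ refl) cl⁻
      where
      -- The end point is generalised to a variable because `centre` cannot be matched at `e j`.
      cl⁺ : ∀ {v} → e j ≡ v → Cl (reduct f M) (e i) v → Sat M (cluster i j) e
      cl⁺ eq   centre       = inj₁ (sym eq)
      cl⁺ refl (clique h k) = inj₂ (h , k)

      cl⁻ : Sat M (cluster i j) e → Cl (reduct f M) (e i) (e j)
      cl⁻ (inj₁ eq)      = subst (Cl (reduct f M) (e i)) eq centre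
      cl⁻ (inj₂ (h , k)) = clique h k

    -- Taken over all colours, these express `Embeds` through finitely many definable properties.
    HasPoint HasEdge : Vec Bool k → Pred (Pointed P) 0ℓ
    HasPoint c (pointed M _ w) = ∃ λ v → Cl (reduct f M) w v × HasColour c M v
    HasEdge c (pointed M _ w) =
      ∃₂ λ u v → Cl (reduct f M) w u × Cl (reduct f M) w v × Model._⊏_ M u v × HasColour c M u × HasColour c M v

    Atom : Fin k → Pred (Pointed P) 0ℓ
    Atom p (pointed M _ w) = Model.‖_‖ M (f p) w

    atom-definable : ∀ p → Definable (Atom p)
    atom-definable p .formula i   = pred (f p) i
    atom-definable p .correct e i = ⇔-id _

    hasPoint-definable : ∀ c → Definable (HasPoint c)
    hasPoint-definable c .formula i = ∃′ (cluster (suc i) zero ∧′ colour c (allFin k) zero)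
    hasPoint-definable c .correct {M} e i = mk⇔
      (λ (v , d , h) → v , cl v .to d , co v .to h)
      (λ (v , s , t) → v , cl v .from s , co v .from t)
      where
      cl = λ v → cluster-correct M (v ∷ᶠ e) (suc i) zero
      co = λ v → colour-correct M (v ∷ᶠ e) zero c

    hasEdge-definable : ∀ c → Definable (HasEdge c)
    hasEdge-definable c .formula i = ∃′ (∃′
      (cluster (suc (suc i)) (suc zero) ∧′ (cluster (suc (suc i)) zero ∧′ ((suc zero ⊏′ zero) ∧′
      (colour c (allFin k) (suc zero) ∧′ colour c (allFin k) zero)))))
    hasEdge-definable c .correct {M} e i = mk⇔
      (λ (u , v , d , d′ , u⊏v , h , h′) → u , v ,
        cl u v (suc zero) .to d , cl u v zero .to d′ , u⊏v , co u v (suc zero) .to h , co u v zero .to h′)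
      (λ (u , v , s , s′ , u⊏v , t , t′) → u , v ,
        cl u v (suc zero) .from s , cl u v zero .from s′ , u⊏v , co u v (suc zero) .from t , co u v zero .from t′)
      where
      cl = λ u v → cluster-correct M (v ∷ᶠ (u ∷ᶠ e)) (suc (suc i))
      co = λ u v j → colour-correct M (v ∷ᶠ (u ∷ᶠ e)) j c

    closed : Pointed P → Valued (Fin k) 0
    closed x = valued (reduct f (x .model)) (x .class .proj₁) []ᶠ

    Local : Rel (Pointed P) 0ℓ
    Local x y = Same (closed x) (closed y) (x .point) (y .point) ×
                Matching (closed x) (closed y) (x .point) (y .point)

    sameColour : ∀ {x y c v w} → HasColour c (x .model) v → HasColour c (y .model) w →
                 Same (closed x) (closed y) v w
    sameColour h k = same (λ p → ⇔-sym (k p) ⇔-∘ h p) λ ()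

    embeds : ∀ x y → (∀ c → HasPoint c x → HasPoint c y) → (∀ c → HasEdge c x → HasEdge c y) →
             Embeds (closed x) (closed y) (x .point) (y .point)
    embeds x y hp he .Embeds.point {v} d =
      let h = colourOf-correct (x .model) v
          v′ , d′ , h′ = hp (colourOf (x .model) v) (v , d , h) in
      v′ , d′ , sameColour {x} {y} {colourOf (x .model) v} h h′
    embeds x y hp he .Embeds.edge {u} {v} d d′ u⊏v s =
      let c = colourOf (x .model) u
          h = colourOf-correct (x .model) u
          k = λ p → h p ⇔-∘ ⇔-sym (s .Same.atoms p)
          u′ , v′ , e , e′ , u′⊏v′ , h′ , k′ = he c (u , v , d , d′ , u⊏v , h , k) in
      u′ , v′ , e , e′ , u′⊏v′ , sameColour {x} {y} {c} h h′ , sameColour {x} {y} {c} k k′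

    local-controlled : Controlled Local
    local-controlled =
      let Λ , h = controlled-× (controlled-∀∈ (allFin k) (λ {p} _ → controlled-⇔ (atom-definable p)))
                 (controlled-× (controlled-∀∈ (bitvectors k) (λ {c} _ → controlled-⇔ (hasPoint-definable c)))
                               (controlled-∀∈ (bitvectors k) (λ {c} _ → controlled-⇔ (hasEdge-definable c))))
      in Λ , λ {x} {y} ag → let atoms , points , edges = h ag in
        same (λ p → atoms (∈-allFin p)) (λ ()) ,
        embeds x y (λ c → points (∈-bitvectors c) .to) (λ c → edges (∈-bitvectors c) .to) ,
        embeds y x (λ c → points (∈-bitvectors c) .from) (λ c → edges (∈-bitvectors c) .from)

    -- Definability of types by induction on lists of types.

    module _ (φ : Formula (Fin k) 0) where

      at : (x : Pointed P) → Model.Carrier (x .model) → Pointed P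
      at x v = pointed (x .model) (x .class) v

      τ : Pointed P → Vec Bool (size φ)
      τ x = type φ (closed x) (x .point)

      AllAboveIn : List (Vec Bool (size φ)) → Pred (Pointed P) 0ℓ
      AllAboveIn S x = ∀ v → Model._≺_ (x .model) (x .point) v → τ (at x v) ∈ S

      _≟_ : (s t : Vec Bool (size φ)) → Dec (s ≡ t)
      _≟_ = ≡-dec Bool._≟_

      _∖_ : List (Vec Bool (size φ)) → Vec Bool (size φ) → List (Vec Bool (size φ))
      S ∖ t = filter (λ s → ¬? (s ≟ t)) S

      ∖-length : ∀ {S t} → t ∈ S → length (S ∖ t) < length S
      ∖-length {S} t∈S = filter-notAll _ S (Any.map (λ eq ¬eq → ¬eq (sym eq)) t∈S)

      -- The conditional type: nothing is claimed about points with a type outside `S` above them.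
      TypeDetermined : List (Vec Bool (size φ)) → Rel (Pointed P) 0ℓ
      TypeDetermined S x y = AllAboveIn S x → AllAboveIn S y × τ x ≡ τ y

      -- If S ∖ t still contains all types above x or above y, smaller lists
      -- decide; otherwise exactly the types in S occur above x and above y.
      same-type : ∀ {S x y} → Local x y →
                  (∀ {t} → t ∈ S → TypeDetermined (S ∖ t) x y × TypeDetermined (S ∖ t) y x) →
                  AllAboveIn S x → AllAboveIn S y → τ x ≡ τ y
      same-type {S} {x} {y} (same-xy , match) smaller gx gy
        with em₀ {∃ λ t → t ∈ S × (AllAboveIn (S ∖ t) x ⊎ AllAboveIn (S ∖ t) y)}
      ... | yes (t , t∈S , inj₁ h) = smaller t∈S .proj₁ h .proj₂
      ... | yes (t , t∈S , inj₂ h) = sym (smaller t∈S .proj₂ h .proj₂)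
      ... | no ∄ = determined φ (alike match
                     ( realised x y gx gy (λ t t∈S h → ∄ (t , t∈S , inj₂ h))
                     , realised y x gy gx (λ t t∈S h → ∄ (t , t∈S , inj₁ h))))
                     centre centre same-xy
        where
        realised : ∀ x y → AllAboveIn S x → AllAboveIn S y → (∀ t → t ∈ S → ¬ AllAboveIn (S ∖ t) y) →
                   Above φ (closed x) (closed y) (x .point) (y .point)
        realised x y gx gy ¬sub {v} w≺v
          with em₀ {∃ λ v′ → Model._≺_ (y .model) (y .point) v′ × τ (at x v) ≡ τ (at y v′)}
        ... | yes found = found
        -- If the type of `v` did not occur above `y`, all types above `y` would remain in `S` after
        -- its removal.
        ... | no ∄ = contradiction
          (λ v′ w≺v′ → ∈-filter⁺ _ (gy v′ w≺v′) (λ eq → ∄ (v′ , w≺v′ , sym eq)))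
          (¬sub _ (gx v w≺v))

      -- The bound `m` on the length makes the recursion structural. `Λ` joins the cluster data to
      -- the properties for the lists with one type removed; `AllAboveIn S` is defined from `Λ` and
      -- then put in front of it.
      type-determined : ∀ m S → length S < m → Controlled (TypeDetermined S)
      type-determined (suc m) S (s≤s S≤m) =
        (AllAboveIn S , above-definable) ∷ Λ , λ { (g ∷ ag) gx → g .to gx , core ag gx (g .to gx) }
        where
        smaller : Controlled (λ x y → ∀ {t} → t ∈ S → TypeDetermined (S ∖ t) x y × TypeDetermined (S ∖ t) y x)
        smaller = controlled-∀∈ S λ {t} t∈S →
          let ih = type-determined m (S ∖ t) (<-≤-trans (∖-length t∈S) S≤m) in
          controlled-× ih (controlled-flip ih)

        both = controlled-× local-controlled smaller
        Λ    = both .proj₁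

        core : ∀ {x y} → Agree Λ x y → AllAboveIn S x → AllAboveIn S y → τ x ≡ τ y
        core {x} {y} ag = same-type {S} {x} {y} (both .proj₂ ag .proj₁) (both .proj₂ ag .proj₂)

        -- Depends only on `Λ`, and by `core` amounts to `τ x ∈ S` as soon as all types above `x`
        -- lie in `S`.
        Admissible : Pred (Pointed P) (lsuc 0ℓ)
        Admissible x = ∃ λ y → Agree Λ x y × AllAboveIn S y × τ y ∈ S

        admissible-definable : Definable Admissible
        admissible-definable = define Λ λ ag (z , ag′ , h) → z , Agree-trans (Agree-sym ag) ag′ , h

        admissible⁺ : ∀ {x} → AllAboveIn S x → τ x ∈ S → Admissible x
        admissible⁺ gx τx = _ , Agree-refl , gx , τx

        admissible⁻ : ∀ {x} → AllAboveIn S x → Admissible x → τ x ∈ S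
        admissible⁻ gx (y , ag , gy , τy) = subst (_∈ S) (sym (core ag gx gy)) τy

        AboveAdmissible : Pred (Pointed P) (lsuc 0ℓ)
        AboveAdmissible x = ∀ v → Model._≺_ (x .model) (x .point) v → Admissible (at x v)

        ≺-trans : ∀ x {v u} → Model._≺_ (x .model) (x .point) v → Model._≺_ (x .model) v u →
                  Model._≺_ (x .model) (x .point) u
        ≺-trans x w≺v (v⊏u , _) = Clusters.≺-upset (x .model) (x .class .proj₁) w≺v v⊏u

        above⁺ : ∀ {x} → AllAboveIn S x → AboveAdmissible x
        above⁺ {x} g v w≺v = admissible⁺ (λ u v≺u → g u (≺-trans x w≺v v≺u)) (g v w≺v)

        above⁻ : ∀ {x} → AboveAdmissible x → AllAboveIn S x
        above⁻ {x} h v w≺v = go v w≺v (PathFinite⇒WellFounded {M = x .model} (x .class .proj₂) v)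
          where
          go : ∀ v → Model._≺_ (x .model) (x .point) v → Acc (flip (Model._≺_ (x .model))) v → τ (at x v) ∈ S
          -- Points strictly above `v` are strictly above the base point too, so the recursive calls
          -- supply the assumption of `admissible⁻` at `v`.
          go v w≺v (acc rec) = admissible⁻ (λ u v≺u → go u (≺-trans x w≺v v≺u) (rec v≺u)) (h v w≺v)

        above-definable : Definable (AllAboveIn S)
        above-definable .formula i =
          ∀′ ((¬′ ((suc i ⊏′ zero) ∧′ (¬′ (zero ⊏′ suc i)))) ∨′ admissible-definable .formula zero)
        above-definable .correct {M} {c} e i = mk⇔ to′ from′
          where
          x = pointed M c (e i)

          to′ : AllAboveIn S x → Sat M (above-definable .formula i) e
          to′ g v with em₀ {Model._≺_ M (e i) v}
          ... | yes w≺v = inj₂ (admissible-definable .correct {c = c} (v ∷ᶠ e) zero .to (above⁺ g v w≺v))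
          ... | no ¬w≺v = inj₁ ¬w≺v

          from′ : Sat M (above-definable .formula i) e → AllAboveIn S x
          from′ s = above⁻ λ v w≺v → case s v of λ
            { (inj₁ ¬w≺v) → contradiction w≺v ¬w≺v
            ; (inj₂ t)    → admissible-definable .correct {c = c} (v ∷ᶠ e) zero .from t }

      -- For the list of all bit vectors the condition on the types above is automatic, so agreement
      -- gives equal types and hence equal truth values.
      truth-definable : Definable (λ x → closed x ∋ x .point ⊩ φ)
      truth-definable =
        let Λ , h = type-determined _ (bitvectors (size φ)) ≤-refl in
        define Λ λ {x} {y} ag →
          type-truth φ {closed x} {closed y} (h {x} {y} ag (λ v _ → ∈-bitvectors (τ (at x v))) .proj₂)

mainTheorem3 : ExcludedMiddle (lsuc 0ℓ) →
    ∀ (P : Set) (φ : Formula P 0) →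
    ∃ λ (θ : FO P 1) →
    BisimulationInvariantOver PathFiniteWK4 θ ×
    EquivalentOver PathFiniteWK4 φ θ ×
    EquivalentOver FiniteWK4 φ θ
mainTheorem3 em P φ = θ , invariant , equivalent , λ M → equivalent M ∘ FiniteWK4⇒PathFiniteWK4 {M = M}
  where
  open Types em using (FiniteWK4⇒PathFiniteWK4)

  ps = constants φ

  relabelled : Relabelling ps φ
  relabelled = relabel ps φ id

  definable = Definability.truth-definable em (List.lookup ps) (relabelled .proj₁)

  θ : FO P 1
  θ = definable .formula zero

  equivalent : EquivalentOver PathFiniteWK4 φ θ
  equivalent M c w = definable .correct {M} {c} (w ∷ᶠ []ᶠ) zero ⇔-∘
                     relabelled .proj₂ M []ᶠ w

  -- Inherited from `φ`: both models lie in the class, so `θ` may be exchanged for `φ` on either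
  -- side.
  invariant : BisimulationInvariantOver PathFiniteWK4 θ
  invariant M N cM cN ι bis u v r =
    equivalent N cN v ⇔-∘
    (mk⇔ (⟦⟧-bisim bis φ (λ ()) r) (⟦⟧-bisim (converse bis) φ (λ ()) r) ⇔-∘
     ⇔-sym (equivalent M cM u))
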